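{- There exist an absolute constant $C$, a labeling scheme, and a deterministic distributed algorithm using its labels such that, for every $k\ge 1$ and every instance of $k$-gathering on a radio network with diameter $D$ and maximum degree $\Delta\geq 1$, the labeling scheme has length at most $C\,(1+\min(\log k,\log\Delta))$ on this instance and the algorithm accomplishes $k$-gathering in at most $D+k$ rounds.
   Context: Radio network: a finite simple undirected connected graph $G=(V,E)$. Computation proceeds in synchronous rounds. In each round every node either transmits a message to all its neighbors or listens. A node $v$ receives the message of a neighbor $w$ in a round iff $v$ listens in this round and $w$ is the only neighbor of $v$ transmitting in this round; otherwise $v$ receives nothing, and cannot tell whether any neighbor transmitted. There is no bound on message size, so several source messages may be combined in one transmission. $k$-gathering: an instance is a network with $k$ distinct nodes $s_1,\dots,s_k$ (sources), each holding a message, and a node $s$ (sink). All $k$ messages must reach $s$. Labeling scheme: assigns to each node of each instance a binary string (its label), possibly depending on the whole instance; labels need not be distinct. Its length is the maximum length of an assigned label. In a deterministic distributed algorithm all nodes run the same algorithm (the same for all instances); initially a node knows only its own label and, if it is a source, its message. Nodes know nothing else about the network. Non-spontaneous wake-up: only the sources start at round $0$; any other node joins only after receiving a message. The current round number may be attached to every message, so a node that has been woken up knows the global round number. All logarithms are to base 2. -}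

module Defs where

open import Data.Bool using (Bool; if_then_else_; _∨_)
open import Data.Fin using (Fin; _≟_)
open import Data.Fin.Properties using (any?)
open import Data.List using (List; []; _∷_; length; map; mapMaybe; filter; any; allFin)
open import Data.List.Extrema.Nat using (max)
open import Data.List.Membership.Propositional using (_∈_)
open import Data.Maybe using (Maybe; just; nothing; is-just)
open import Data.Nat using (ℕ; zero; suc; _≤_)
open import Data.Product using (_×_; _,_; ∃; ∃₂)
open import Function.Bundles using (_⇔_)
open import Function.Definitions using (Injective)
open import Level using (0ℓ)
open import Relation.Binary using (Rel; Decidable; Symmetric; Irreflexive)
open import Relation.Binary.PropositionalEquality using (_≡_)
open import Relation.Nullary using (yes; no)

record Graph (n : ℕ) : Set₁ where
  infix 4 _~_ _~?_
  field
    _~_    : Rel (Fin n) 0ℓ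
    _~?_   : Decidable _~_
    sym    : Symmetric _~_
    irrefl : Irreflexive _≡_ _~_

  neighbours : Fin n → List (Fin n)
  neighbours v = filter (v ~?_) (allFin n)

  degree : Fin n → ℕ
  degree v = length (neighbours v)

  data Walk : Fin n → Fin n → ℕ → Set where
    []  : ∀ {u} → Walk u u zero
    _∷_ : ∀ {u v w d} → u ~ v → Walk v w d → Walk u w (suc d)

  Connected : Set
  Connected = ∀ u v → ∃ λ d → Walk u v d

  Distance : Fin n → Fin n → ℕ → Set
  Distance u v d = Walk u v d × (∀ e → Walk u v e → d ≤ e)

  Diameter : ℕ → Set
  Diameter D = (∀ u v d → Distance u v d → d ≤ D) × (∃₂ λ u v → Distance u v D)

  MaxDegree : ℕ → Set
  MaxDegree Δ = (∀ v → degree v ≤ Δ) × (∃ λ v → degree v ≡ Δ)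

-- The contents of the source messages are not part of an instance: labels
-- cannot depend on them.
record Instance (k : ℕ) : Set₁ where
  field
    n         : ℕ
    graph     : Graph n
    connected : Graph.Connected graph
    source    : Fin k → Fin n
    distinct  : Injective _≡_ _≡_ source
    sink      : Fin n
  open Graph graph public

Label Message : Set
Label   = List Bool
Message = List Bool

LabelingScheme : Set₁
LabelingScheme = ∀ {k} (I : Instance k) → Fin (Instance.n I) → Label

schemeLength : LabelingScheme → ∀ {k} → Instance k → ℕ
schemeLength scheme I = max 0 (map (λ v → length (scheme I v)) (allFin (Instance.n I)))

-- What a node received in each of the past rounds, most recent round first.
-- The length of a history is the number of the current round, which every
-- node that is awake knows.
History : Set
History = List (Maybe Message)

record Algorithm : Set where
  field
    -- From the node's label, its source message (if it is a source) and its
    -- history: the string to transmit, or 'nothing' to listen.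
    transmit : Label → Maybe Message → History → Maybe Message
    -- The source messages the node has learnt, given the same information.
    known    : Label → Maybe Message → History → List Message

-- Non-spontaneous wake-up: a non-source sleeps until it receives something.
awake : Maybe Message → History → Bool
awake own h = is-just own ∨ any is-just h

only : {A : Set} → List A → Maybe A
only (x ∷ []) = just x
only _        = nothing

module Execution (𝒜 : Algorithm) {k : ℕ} (I : Instance k)
                 (label : Fin (Instance.n I) → Label)
                 (message : Fin k → Message) where
  open Algorithm 𝒜
  open Instance I

  ownMessage : Fin n → Maybe Message
  ownMessage v with any? (λ i → source i ≟ v)
  ... | yes (i , _) = just (message i)
  ... | no  _       = nothing

  sent : (Fin n → History) → Fin n → Maybe Message
  sent h v = if awake (ownMessage v) (h v)
             then transmit (label v) (ownMessage v) (h v)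
             else nothing

  received : (Fin n → History) → Fin n → Maybe Message
  received h v with sent h v
  ... | just _  = nothing
  ... | nothing = only (mapMaybe (sent h) (neighbours v))

  -- histories t v is the history of v after rounds 0, …, t - 1.
  histories : ℕ → Fin n → History
  histories zero    v = []
  histories (suc t) v = received (histories t) v ∷ histories t v

  knows : ℕ → Fin n → List Message
  knows t v = known (label v) (ownMessage v) (histories t v)

  -- The sink must have determined exactly the set of source messages: an
  -- output padded with guesses does not count.
  Gathered : ℕ → Set
  Gathered t = ∀ m → (m ∈ knows t sink) ⇔ (∃ λ i → message i ≡ m)

AccomplishesGathering : Algorithm → LabelingScheme → ∀ {k} → Instance k → ℕ → Set
AccomplishesGathering 𝒜 scheme {k} I T =
  ∀ (message : Fin k → Message) t → T ≤ t →
  Execution.Gathered 𝒜 I (scheme I) message t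

{-# OPTIONS --safe #-}
module Submission where

-- Layer the network by distance to the sink, and let the backbone T be an
-- inclusion-minimal set of nodes that contains all sources and in which every
-- member except the sink has a neighbour in T one layer closer.  Every member
-- other than the sink transmits exactly once, to one such neighbour, its
-- parent, and sends everything it knows.  By minimality every member p that
-- is not a source has a private child: a member whose only neighbour in T one
-- layer closer is p (private-exists).
--
-- A serial schedule ("slot") handles the layers from the farthest to the
-- nearest.  In each layer one private child of every non-source in the next
-- layer is chosen, and all chosen nodes transmit together without disturbing
-- one another; the remaining members, the extras, follow one at a time.
-- There are at most k extras in total (extras≤k): the members are the sources
-- and the non-sources, and the latter inject into the chosen nodes.  So the
-- slots stay below height + k, where height is at most the diameter.
--
-- The serial schedule cannot be announced by short labels, because a node does
-- not know when its layer begins.  It is therefore compacted: in the order of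
-- the slots, each node takes the first round ("time") that follows those of
-- its children and differs from those of the clashing nodes with a smaller
-- slot.  Its slot is always such a round, so no node gets later (time<), and a
-- round which a node spends waiting after hearing its last child is the
-- transmission round of some node clashing with it (time-tight).
--
-- The label of a node records what the node has observed when its round comes:
-- how often it has received something, and for how many rounds it has received
-- nothing since then.  These two numbers determine the round
-- (code-transcript-injective).  Both are bounded by the number of members that
-- clash with the node or are adjacent to it, hence by 5k, since these lie in
-- five layers and a layer has at most k members (∈-layer), and by a quadratic
-- polynomial in the maximum degree.  So their binary codes have the required
-- length (label-length).
--
-- In the algorithm a node transmits once its observations match its label.  By
-- induction on the rounds the run follows the plan (consistent), so every
-- message climbs from parent to parent into the sink (climb).

open import Defs
open import Data.Bool using (Bool; true; false; if_then_else_) renaming (_≟_ to _≟ᵇ_)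
open import Data.Bool.ListAction using (or)
open import Data.Fin using (Fin; _≟_) renaming (toℕ to index)
open import Data.Fin.Properties using (any?; all?; toℕ-injective)
open import Data.Fin.Subset using (Subset; ⊤; _-_; ∣_∣) renaming (_∈_ to _∈ˢ_)
open import Data.Fin.Subset.Properties
  using (_∈?_; ∈⊤; p─q⊆p; x∈p∧x≢y⇒x∈p-y; x∈p⇒∣p-x∣<∣p∣)
open import Data.List
  using (List; []; _∷_; [_]; _++_; length; map; filter; concatMap; mapMaybe; fromMaybe;
         downFrom; allFin)
open import Data.List.Extrema.Nat using (max; xs≤max; max≤v⁺)
open import Data.List.Membership.Propositional using (_∈_)
open import Data.List.Membership.Propositional.Properties
  using (∈-∃++; ∈-++⁻; ∈-++⁺ˡ; ∈-++⁺ʳ; ∈-filter⁻; ∈-filter⁺; ∈-map⁺; ∈-allFin; ∈-concatMap⁺)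
open import Data.List.Properties
  using (length-++; length-map; length-tabulate; length-filter; ++-assoc; ++-identityʳ; ∷-injective)
  renaming (≡-dec to list-≟)
import Data.List.Relation.Unary.All as All
open import Data.List.Relation.Unary.All.Properties using () renaming (map⁺ to All-map⁺)
open import Data.List.Relation.Unary.Any using (here; there)
import Data.List.Relation.Unary.Any as Any
open import Data.List.Relation.Unary.Unique.Propositional using (Unique; []; _∷_)
open import Data.List.Relation.Unary.Unique.Propositional.Properties using (allFin⁺; filter⁺)
open import Data.Maybe using (Maybe; just; nothing; is-just)
open import Data.Maybe.Properties using (just-injective)
open import Data.Nat hiding (_≟_)
import Data.Nat as ℕ
open import Data.Nat.Binary using (ℕᵇ; 2[1+_]; 1+[2_]; toℕ; fromℕ) renaming (zero to 0ᵇ)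
open import Data.Nat.Binary.Properties using (toℕ-fromℕ)
open import Data.Nat.Induction using (<-wellFounded)
open import Data.Nat.Logarithm using (⌊log₂_⌋; ⌊log₂⌋-mono-≤; ⌊log₂[2^n]⌋≡n)
open import Data.Nat.Properties hiding (_≟_)
open import Data.Nat.Solver using (module +-*-Solver)
open import Data.Product using (_×_; _,_; ∃; proj₁; proj₂; Σ-syntax)
open import Data.Sum using (_⊎_; inj₁; inj₂; [_,_]′)
open import Data.Unit using (tt) renaming (⊤ to Unit)
open import Function using (_∘_; id)
open import Function.Bundles using (mk⇔)
open import Induction.WellFounded using (Acc; acc)
open import Relation.Binary using (Decidable; tri<; tri≈; tri>)
open import Relation.Binary.PropositionalEquality hiding ([_])
open import Relation.Nullary using (¬_; yes; no; contradiction; Dec; ¬?; does)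
open import Relation.Nullary.Decidable
  using (_×-dec_; _⊎-dec_; _→-dec_; dec-true; dec-false; toSum; decidable-stable)
import Relation.Unary as Unary
open +-*-Solver using (solve; con; _:+_; _:*_; _:=_)

-- Counting and searching in finite sets

Unique⇒length≤ : {A : Set} {xs ys : List A} → Unique xs →
                 (∀ {x} → x ∈ xs → x ∈ ys) → length xs ≤ length ys
Unique⇒length≤ [] _ = z≤n
Unique⇒length≤ {xs = x ∷ xs} (x∉xs ∷ u) sub with ∈-∃++ (sub (here refl))
... | as , bs , refl = begin
  suc (length xs)              ≤⟨ s≤s (Unique⇒length≤ u sub′) ⟩
  suc (length (as ++ bs))      ≡⟨ cong suc (length-++ as) ⟩
  suc (length as + length bs)  ≡⟨ sym (+-suc (length as) (length bs)) ⟩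
  length as + suc (length bs)  ≡⟨ sym (length-++ as) ⟩
  length (as ++ x ∷ bs)        ∎
  where
  open ≤-Reasoning
  sub′ : ∀ {y} → y ∈ xs → y ∈ as ++ bs
  sub′ y∈xs with ∈-++⁻ as (sub (there y∈xs))
  ... | inj₁ y∈as         = ∈-++⁺ˡ y∈as
  ... | inj₂ (here refl)  = contradiction refl (All.lookup x∉xs y∈xs)
  ... | inj₂ (there y∈bs) = ∈-++⁺ʳ as y∈bs

length-concatMap : ∀ {A B : Set} (f : A → List B) xs m →
                   (∀ {x} → x ∈ xs → length (f x) ≤ m) →
                   length (concatMap f xs) ≤ length xs * m
length-concatMap f []       m _     = z≤n
length-concatMap f (x ∷ xs) m bound = ≤-trans (≤-reflexive (length-++ (f x)))
  (+-mono-≤ (bound (here refl)) (length-concatMap f xs m (bound ∘ there)))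

length-filter-split : {A : Set} {P : A → Set} (P? : Unary.Decidable P) (xs : List A) →
  length (filter P? xs) + length (filter (¬? ∘ P?) xs) ≡ length xs
length-filter-split P? []       = refl
length-filter-split P? (x ∷ xs) with P? x
... | yes _ = cong suc (length-filter-split P? xs)
... | no  _ = trans (+-suc _ _) (cong suc (length-filter-split P? xs))

least : {P : ℕ → Set} → Unary.Decidable P → ∀ b → P b →
        ∃ λ t → t ≤ b × P t × (∀ s → s < t → ¬ P s)
least P? b pb with P? zero
... | yes p₀ = zero , z≤n , p₀ , λ _ ()
least P? zero    pb | no ¬p₀ = contradiction pb ¬p₀
least P? (suc b) pb | no ¬p₀ with least (P? ∘ suc) b pb
... | t , t≤b , pt , min = suc t , s≤s t≤b , pt ,
      λ { zero _ → ¬p₀ ; (suc s) (s≤s s<t) → min s s<t }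

-- Minimality is with respect to the removal of single elements.
minimalSubset : ∀ {n} {P : Subset n → Set} → Unary.Decidable P → P ⊤ →
                ∃ λ p → P p × (∀ x → x ∈ˢ p → ¬ P (p - x))
minimalSubset {n} {P} P? = shrink ⊤ (<-wellFounded _)
  where
  shrink : ∀ p → Acc _<_ ∣ p ∣ → P p → ∃ λ q → P q × (∀ x → x ∈ˢ q → ¬ P (q - x))
  shrink p (acc rec) Pp with any? (λ x → (x ∈? p) ×-dec P? (p - x))
  ... | yes (x , x∈p , P-x) = shrink (p - x) (rec (x∈p⇒∣p-x∣<∣p∣ x∈p)) P-x
  ... | no none = p , Pp , λ x x∈p P-x → none (x , x∈p , P-x)

-- Self-delimiting binary codes

-- Prepends m to r in a decodable way: every bit of m is preceded by true, and
-- false marks its end.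
frame : List Bool → List Bool → List Bool
frame []      r = false ∷ r
frame (b ∷ m) r = true ∷ b ∷ frame m r

encode : List (List Bool) → List Bool
encode []       = []
encode (m ∷ ms) = frame m (encode ms)

-- The first argument holds the bits of the current string read so far.
parse : List Bool → List Bool → List (List Bool)
parse m₀ []             = []
parse m₀ (false ∷ r)    = m₀ ∷ parse [] r
parse m₀ (true ∷ [])    = []
parse m₀ (true ∷ b ∷ r) = parse (m₀ ++ [ b ]) r

decode : List Bool → List (List Bool)
decode = parse []

parse-frame : ∀ m₀ m r → parse m₀ (frame m r) ≡ (m₀ ++ m) ∷ parse [] r
parse-frame m₀ []      r = cong (_∷ parse [] r) (sym (++-identityʳ m₀))
parse-frame m₀ (b ∷ m) r = trans (parse-frame (m₀ ++ [ b ]) m r)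
                                  (cong (_∷ parse [] r) (++-assoc m₀ [ b ] m))

decode-encode : ∀ ms → decode (encode ms) ≡ ms
decode-encode []       = refl
decode-encode (m ∷ ms) = trans (parse-frame [] m (encode ms)) (cong (m ∷_) (decode-encode ms))

encode-injective : ∀ ms ms′ → encode ms ≡ encode ms′ → ms ≡ ms′
encode-injective ms ms′ eq =
  trans (sym (decode-encode ms)) (trans (cong decode eq) (decode-encode ms′))

length-frame : ∀ m r → length (frame m r) ≡ 2 * length m + suc (length r)
length-frame []      r = refl
length-frame (b ∷ m) r rewrite length-frame m r | +-suc (length m) (length m + 0) = refl

-- Bijective base-2 numeration, least significant digit first: a list of j digits
-- represents a number that is at least 2 ^ j - 1.
digits : ℕᵇ → List Bool
digits 0ᵇ       = []
digits 2[1+ x ] = true ∷ digits x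
digits 1+[2 x ] = false ∷ digits x

digits-injective : ∀ x y → digits x ≡ digits y → x ≡ y
digits-injective 0ᵇ       0ᵇ       eq = refl
digits-injective 2[1+ x ] 2[1+ y ] eq = cong 2[1+_] (digits-injective x y (proj₂ (∷-injective eq)))
digits-injective 1+[2 x ] 1+[2 y ] eq = cong 1+[2_] (digits-injective x y (proj₂ (∷-injective eq)))

length-digits : ∀ x j → toℕ x < 2 ^ j → length (digits x) ≤ j
length-digits 0ᵇ       j       _        = z≤n
length-digits 2[1+ x ] zero    (s≤s ())
length-digits 2[1+ x ] (suc j) lt       =
  s≤s (length-digits x j (<-trans (n<1+n _) (*-cancelˡ-< 2 (suc (toℕ x)) (2 ^ j) lt)))
length-digits 1+[2 x ] zero    (s≤s ())
length-digits 1+[2 x ] (suc j) lt       =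
  s≤s (length-digits x j (*-cancelˡ-< 2 (toℕ x) (2 ^ j) (<-trans (n<1+n _) lt)))

binary : ℕ → List Bool
binary n = digits (fromℕ n)

binary-injective : ∀ {m n} → binary m ≡ binary n → m ≡ n
binary-injective {m} {n} eq =
  trans (sym (toℕ-fromℕ m)) (trans (cong toℕ (digits-injective _ _ eq)) (toℕ-fromℕ n))

length-binary : ∀ n j → n < 2 ^ j → length (binary n) ≤ j
length-binary n j lt = length-digits (fromℕ n) j (subst (_< 2 ^ j) (sym (toℕ-fromℕ n)) lt)

n<2^[1+⌊log₂n⌋] : ∀ n → n < 2 ^ suc ⌊log₂ n ⌋
n<2^[1+⌊log₂n⌋] n = ≰⇒> λ le → 1+n≰n
  (subst (_≤ ⌊log₂ n ⌋) (⌊log₂[2^n]⌋≡n (suc ⌊log₂ n ⌋)) (⌊log₂⌋-mono-≤ le))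

-- What a node has observed so far

-- In a list of booleans that tells for each past round, most recent first,
-- whether something was received: the number of receptions, and the number of
-- rounds since the last one (of all past rounds if there was none).
heard : List Bool → ℕ
heard []          = 0
heard (true ∷ p)  = suc (heard p)
heard (false ∷ p) = heard p

silence : List Bool → ℕ
silence []          = 0
silence (true ∷ p)  = 0
silence (false ∷ p) = suc (silence p)

-- The label of a node that transmits when its past receptions are p.
code : List Bool → List Bool
code p = encode (binary (heard p) ∷ binary (silence p) ∷ [])

code≢[] : ∀ p → code p ≢ []
code≢[] p eq with encode-injective (binary (heard p) ∷ binary (silence p) ∷ []) [] eq
... | ()

code-injective : ∀ p q → code p ≡ code q → heard p ≡ heard q × silence p ≡ silence q
code-injective p q eq with ∷-injective (encode-injective (_ ∷ _ ∷ []) (_ ∷ _ ∷ []) eq)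
... | eq₁ , eq₂ = binary-injective eq₁ , binary-injective (proj₁ (∷-injective eq₂))

heard-++ : ∀ xs p → heard p ≤ heard (xs ++ p)
heard-++ []           p = ≤-refl
heard-++ (true ∷ xs)  p = m≤n⇒m≤1+n (heard-++ xs p)
heard-++ (false ∷ xs) p = heard-++ xs p

longer-silence : ∀ xs p → heard p ≡ heard (xs ++ p) →
                 silence (xs ++ p) ≡ length xs + silence p
longer-silence []           p eq = refl
longer-silence (true ∷ xs)  p eq = contradiction (heard-++ xs p) (<⇒≱ (≤-reflexive (sym eq)))
longer-silence (false ∷ xs) p eq = cong suc (longer-silence xs p eq)

-- As rounds pass, either another reception is counted or the silence gets longer.
code-grows : ∀ x xs p → code p ≢ code (x ∷ xs ++ p)
code-grows x xs p eq with code-injective p (x ∷ xs ++ p) eq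
... | eq₁ , eq₂ = m≢1+n+m (silence p) (trans eq₂ (longer-silence (x ∷ xs) p eq₁))

-- Here f tells in which rounds something is received.
module _ (f : ℕ → Bool) where

  -- Rounds 0, …, t - 1, most recent first.
  transcript : ℕ → List Bool
  transcript t = map f (downFrom t)

  transcript-extends : ∀ {s t} → s < t →
                       ∃ λ x → ∃ λ xs → transcript t ≡ x ∷ xs ++ transcript s
  transcript-extends {s} {suc t} (s≤s s≤t) with m≤n⇒m<n∨m≡n s≤t
  ... | inj₂ refl = f t , [] , refl
  ... | inj₁ s<t with transcript-extends s<t
  ...   | x , xs , eq = f t , x ∷ xs , cong (f t ∷_) eq

  code-transcript-injective : ∀ s t → code (transcript s) ≡ code (transcript t) → s ≡ t
  code-transcript-injective s t eq with <-cmp s t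
  ... | tri≈ _ s≡t _ = s≡t
  ... | tri< s<t _ _ with transcript-extends s<t
  ...   | x , xs , e = contradiction (trans eq (cong code e)) (code-grows x xs _)
  code-transcript-injective s t eq | tri> _ _ t<s with transcript-extends t<s
  ...   | x , xs , e = contradiction (trans (sym eq) (cong code e)) (code-grows x xs _)

  -- Rounds before t with a reception, and rounds since which nothing has been
  -- received before round t.
  HeardTime QuietTime : ℕ → ℕ → Set
  HeardTime t s = s < t × f s ≡ true
  QuietTime t s = s < t × (∀ r → s ≤ r → r < t → f r ≡ false)

  heard-times : ∀ t → ∃ λ zs → Unique zs × length zs ≡ heard (transcript t) ×
                      (∀ {s} → s ∈ zs → HeardTime t s)
  heard-times zero = [] , [] , refl , λ ()
  heard-times (suc t) with f t in eq | heard-times t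
  ... | false | zs , u , len , mem = zs , u , len , λ s∈ →
        m<n⇒m<1+n (proj₁ (mem s∈)) , proj₂ (mem s∈)
  ... | true  | zs , u , len , mem =
        t ∷ zs , All.tabulate (λ s∈ → >⇒≢ (proj₁ (mem s∈))) ∷ u , cong suc len ,
        λ { (here refl) → n<1+n _ , eq
          ; (there s∈)  → m<n⇒m<1+n (proj₁ (mem s∈)) , proj₂ (mem s∈) }

  quiet-times : ∀ t → ∃ λ zs → Unique zs × length zs ≡ silence (transcript t) ×
                      (∀ {s} → s ∈ zs → QuietTime t s)
  quiet-times zero = [] , [] , refl , λ ()
  quiet-times (suc t) with f t in eq | quiet-times t
  ... | true  | _ = [] , [] , refl , λ ()
  ... | false | zs , u , len , mem =
        t ∷ zs , All.tabulate (λ s∈ → >⇒≢ (proj₁ (mem s∈))) ∷ u , cong suc len , mem′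
    where
    mem′ : ∀ {s} → s ∈ t ∷ zs → QuietTime (suc t) s
    mem′ (here refl) = n<1+n _ , λ r t≤r r≤t →
      subst (λ x → f x ≡ false) (≤-antisym t≤r (s≤s⁻¹ r≤t)) eq
    mem′ {s} (there s∈) = m<n⇒m<1+n (proj₁ (mem s∈)) , quiet
      where
      quiet : ∀ r → s ≤ r → r < suc t → f r ≡ false
      quiet r s≤r r≤t with m≤n⇒m<n∨m≡n (s≤s⁻¹ r≤t)
      ... | inj₁ r<t  = proj₂ (mem s∈) r s≤r r<t
      ... | inj₂ refl = eq

-- Distances

module Distances {n} (G : Graph n) where
  open Graph G hiding (sym)

  walk? : ∀ u v d → Dec (Walk u v d)
  walk? u v zero with u ≟ v
  ... | yes refl = yes []
  ... | no  u≢v  = no λ { [] → u≢v refl }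
  walk? u v (suc d) with any? (λ w → (u ~? w) ×-dec walk? w v d)
  ... | yes (w , u~w , p) = yes (u~w ∷ p)
  ... | no  none          = no λ { (u~w ∷ p) → none (_ , u~w , p) }

  distance : Connected → ∀ u v → ∃ (Distance u v)
  distance conn u v with conn u v
  ... | d , p with least (walk? u v) d p
  ...   | e , _ , q , min = e , q , λ f r → ≮⇒≥ λ f<e → min f f<e r

-- The backbone and its serial schedule

module Backbone {k} (I : Instance k) where
  open Instance I public renaming (sym to ~-sym)
  open Distances graph

  private variable
    u v w p : Fin n

  abstract
    level : Fin n → ℕ
    level v = proj₁ (distance connected v sink)

    level-distance : ∀ v → Distance v sink (level v)
    level-distance v = proj₂ (distance connected v sink)

  level-~ : v ~ w → level v ≤ suc (level w)
  level-~ v~w = proj₂ (level-distance _) _ (v~w ∷ proj₁ (level-distance _))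

  -- w is a neighbour of v one layer closer to the sink.
  Lower : Fin n → Fin n → Set
  Lower v w = v ~ w × level v ≡ suc (level w)

  lower? : ∀ v w → Dec (Lower v w)
  lower? v w = (v ~? w) ×-dec (level v ℕ.≟ suc (level w))

  lower-neighbour : ∀ v → v ≢ sink → ∃ (Lower v)
  lower-neighbour v v≢s with level v | level-distance v
  ... | zero  | [] , _ = contradiction refl v≢s
  ... | suc d | (v~w ∷ q) , min = _ , v~w , cong suc (≤-antisym
        (s≤s⁻¹ (min _ (v~w ∷ proj₁ (level-distance _)))) (proj₂ (level-distance _) d q))

  level>0 : v ≢ sink → 0 < level v
  level>0 {v} v≢s with lower-neighbour v v≢s
  ... | _ , _ , eq = subst (0 <_) (sym eq) z<s

  height : ℕ
  height = max 0 (map level (allFin n))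

  level≤height : ∀ v → level v ≤ height
  level≤height v = All.lookup (xs≤max 0 (map level (allFin n))) (∈-map⁺ level (∈-allFin v))

  height≤diameter : ∀ {D} → Diameter D → height ≤ D
  height≤diameter (bound , _) =
    max≤v⁺ z≤n (All-map⁺ (All.universal
      (λ v → bound v sink (level v) (level-distance v)) (allFin n)))

  -- T contains the sources, and every node of T has a shortest path to the sink
  -- inside T.
  Closed : Subset n → Set
  Closed T = (∀ i → source i ∈ˢ T) ×
             (∀ v → v ∈ˢ T → v ≢ sink → ∃ λ w → w ∈ˢ T × Lower v w)

  supported? : ∀ T v → Dec (v ∈ˢ T → v ≢ sink → ∃ λ w → w ∈ˢ T × Lower v w)
  supported? T v = (v ∈? T) →-dec (¬? (v ≟ sink) →-dec any? λ w → (w ∈? T) ×-dec lower? v w)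

  closed? : Unary.Decidable Closed
  closed? T = all? (λ i → source i ∈? T) ×-dec all? (supported? T)

  minimal : ∃ λ T → Closed T × (∀ x → x ∈ˢ T → ¬ Closed (T - x))
  minimal = minimalSubset closed?
    ((λ _ → ∈⊤) , λ v _ v≢s → let w , l = lower-neighbour v v≢s in w , ∈⊤ , l)

  abstract
    T : Subset n
    T = proj₁ minimal

    T-closed : Closed T
    T-closed = proj₁ (proj₂ minimal)

    T-minimal : ∀ x → x ∈ˢ T → ¬ Closed (T - x)
    T-minimal = proj₂ (proj₂ minimal)

  Source : Fin n → Set
  Source v = ∃ λ i → source i ≡ v

  source? : Unary.Decidable Source
  source? v = any? λ i → source i ≟ v

  -- The nodes that transmit.
  Active : Fin n → Set
  Active v = v ∈ˢ T × v ≢ sink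

  active? : Unary.Decidable Active
  active? v = (v ∈? T) ×-dec ¬? (v ≟ sink)

  abstract
    -- A lower neighbour in the backbone; the default v is taken only outside Active.
    parent : Fin n → Fin n
    parent v with any? (λ w → (w ∈? T) ×-dec lower? v w)
    ... | yes (w , _) = w
    ... | no  _       = v

    parent-spec : Active v → parent v ∈ˢ T × Lower v (parent v)
    parent-spec {v} (v∈T , v≢s) with any? (λ w → (w ∈? T) ×-dec lower? v w)
    ... | yes (_ , w∈T , l) = w∈T , l
    ... | no  none          = contradiction (proj₂ T-closed v v∈T v≢s) none

  -- v is active, p is a lower neighbour of v, and v has no other one in the backbone.
  Private : Fin n → Fin n → Set
  Private p v = Active v × Lower v p × (∀ w → w ∈ˢ T → Lower v w → w ≡ p)

  private? : ∀ p v → Dec (Private p v)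
  private? p v = active? v ×-dec lower? v p ×-dec
                 all? λ w → (w ∈? T) →-dec (lower? v w →-dec (w ≟ p))

  -- Otherwise p could be removed from the backbone.
  private-exists : p ∈ˢ T → ¬ Source p → ∃ (Private p)
  private-exists {p} p∈T ¬src with any? (private? p)
  ... | yes found = found
  ... | no  none  = contradiction (keep , keep′) (T-minimal p p∈T)
    where
    keep : ∀ i → source i ∈ˢ T - p
    keep i = x∈p∧x≢y⇒x∈p-y (proj₁ T-closed i) λ eq → ¬src (i , eq)
    keep′ : ∀ v → v ∈ˢ T - p → v ≢ sink → ∃ λ w → w ∈ˢ T - p × Lower v w
    keep′ v v∈ v≢s with any? (λ w → (w ∈? T) ×-dec lower? v w ×-dec ¬? (w ≟ p))
    ... | yes (w , w∈T , l , w≢p) = w , x∈p∧x≢y⇒x∈p-y w∈T w≢p , l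
    ... | no  only-p = contradiction (v , active , subst (Lower v) (unique _ w∈T l) l , unique) none
      where
      active : Active v
      active = p─q⊆p T _ v∈ , v≢s
      w∈T = proj₁ (parent-spec active)
      l   = proj₂ (parent-spec active)
      unique : ∀ w → w ∈ˢ T → Lower v w → w ≡ p
      unique w w∈T l = decidable-stable (w ≟ p) λ w≢p → only-p (w , w∈T , l , w≢p)

  abstract
    -- A private child of p; the default p is taken if there is none.
    child : Fin n → Fin n
    child p with any? (private? p)
    ... | yes (v , _) = v
    ... | no  _       = p

    child-private : p ∈ˢ T → ¬ Source p → Private p (child p)
    child-private {p} p∈T ¬src with any? (private? p)
    ... | yes (_ , pr) = pr
    ... | no  none     = contradiction (private-exists p∈T ¬src) none

    child≢⇒private : child p ≢ p → Private p (child p)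
    child≢⇒private {p} c≢p with any? (private? p)
    ... | yes (_ , pr) = pr
    ... | no  none     = contradiction refl c≢p

  parent-private : Private p v → parent v ≡ p
  parent-private (act , _ , unique) = unique _ (proj₁ (parent-spec act)) (proj₂ (parent-spec act))

  level-parent : Active v → level v ≡ suc (level (parent v))
  level-parent act = proj₂ (proj₂ (parent-spec act))

  -- For an active node: it is the private child that its parent selects.
  Chosen : Fin n → Set
  Chosen v = child (parent v) ≡ v

  chosen? : Unary.Decidable Chosen
  chosen? v = child (parent v) ≟ v

  chosen-private : Active v → Chosen v → Private (parent v) v
  chosen-private {v} act ch = subst (Private (parent v)) ch (child≢⇒private λ eq →
    1+n≢n (sym (subst (λ x → level x ≡ suc (level (parent v))) (trans (sym ch) eq)
                      (level-parent act))))

  members : List (Fin n)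
  members = filter (_∈? T) (allFin n)

  ∈-members : v ∈ˢ T → v ∈ members
  ∈-members = ∈-filter⁺ (_∈? T) (∈-allFin _)

  extras : List (Fin n)
  extras = filter (¬? ∘ chosen?) members

  -- Members are non-sources (relays) or sources.  The relays inject into the chosen
  -- members through child, which has parent as a left inverse.
  extras≤k : length extras ≤ k
  extras≤k = +-cancelˡ-≤ (length relays) _ _ (begin
    length relays + length extras                   ≤⟨ +-monoˡ-≤ _ relays≤ ⟩
    length (filter chosen? members) + length extras ≡⟨ length-filter-split chosen? members ⟩
    length members                                  ≤⟨ Unique⇒length≤ members! split ⟩
    length (relays ++ map source (allFin k))        ≡⟨ length-++ relays ⟩
    length relays + length (map source (allFin k))  ≡⟨ cong (length relays +_) |sources| ⟩
    length relays + k                              ∎)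
    where
    open ≤-Reasoning
    members! : Unique members
    members! = filter⁺ (_∈? T) (allFin⁺ n)
    relays = filter (¬? ∘ source?) members
    |sources| : length (map source (allFin k)) ≡ k
    |sources| = trans (length-map source (allFin k)) (length-tabulate id)
    relays≤ : length relays ≤ length (filter chosen? members)
    relays≤ = subst (length relays ≤_) (length-map parent (filter chosen? members))
      (Unique⇒length≤ (filter⁺ (¬? ∘ source?) members!) λ {p} p∈ →
        let p∈m , ¬src = ∈-filter⁻ (¬? ∘ source?) {xs = members} p∈
            pr = child-private (proj₂ (∈-filter⁻ (_∈? T) {xs = allFin n} p∈m)) ¬src
            eq = parent-private pr
        in subst (_∈ map parent (filter chosen? members)) eq
             (∈-map⁺ parent (∈-filter⁺ chosen? (∈-members (proj₁ (proj₁ pr))) (cong child eq))))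
    split : ∀ {v} → v ∈ members → v ∈ relays ++ map source (allFin k)
    split {v} v∈ with source? v
    ... | yes (i , refl) = ∈-++⁺ʳ relays (∈-map⁺ source (∈-allFin i))
    ... | no  ¬src       = ∈-++⁺ˡ (∈-filter⁺ (¬? ∘ source?) v∈ ¬src)

  -- The j-th iterate of parent.
  ancestor : ℕ → Fin n → Fin n
  ancestor zero    v = v
  ancestor (suc j) v = parent (ancestor j v)

  -- Passing to private children leads from v away from the sink until a source is
  -- reached; f bounds the number of layers that remain.
  member-ancestor : ∀ f v → v ∈ˢ T → height ≤ level v + f →
                    ∃ λ i → ∃ λ j → ancestor j (source i) ≡ v × level (source i) ≡ j + level v
  member-ancestor f v v∈T h with source? v
  ... | yes (i , refl) = i , 0 , refl , refl
  ... | no  ¬src with child-private v∈T ¬src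
  member-ancestor zero v v∈T h | no ¬src | pr@(_ , (_ , lc) , _) =
    contradiction (≤-trans (≤-reflexive (sym lc))
                    (≤-trans (level≤height _) (≤-trans h (≤-reflexive (+-identityʳ _))))) 1+n≰n
  member-ancestor (suc f) v v∈T h | no ¬src | pr@(act , (_ , lc) , _)
    with member-ancestor f (child v) (proj₁ act)
           (subst (height ≤_) (trans (+-suc _ f) (cong (_+ f) (sym lc))) h)
  ... | i , j , eq , lv = i , suc j , trans (cong parent eq) (parent-private pr) ,
        trans lv (trans (cong (j +_) lc) (+-suc j _))

  -- One node for each source, among which are all members at level l: a member is
  -- determined by its level and any source whose chain of parents contains it.
  layer : ℕ → List (Fin n)
  layer l = map (λ i → ancestor (level (source i) ∸ l) (source i)) (allFin k)

  length-layer : ∀ l → length (layer l) ≡ k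
  length-layer l = trans (length-map _ (allFin k)) (length-tabulate id)

  ∈-layer : v ∈ˢ T → v ∈ layer (level v)
  ∈-layer {v} v∈T with member-ancestor height v v∈T (m≤n+m height (level v))
  ... | i , j , eq , lv = subst (_∈ layer (level v))
        (trans (cong (λ d → ancestor d (source i))
                     (trans (cong (_∸ level v) lv) (m+n∸n≡m j (level v)))) eq)
        (∈-map⁺ _ (∈-allFin i))

  -- For an extra u: its transmission comes before that of v in the serial schedule,
  -- or u is v.
  Precedes : Fin n → Fin n → Set
  Precedes v u = level v < level u ⊎ (level u ≡ level v × ¬ Chosen v × index u ≤ index v)

  precedes? : ∀ v u → Dec (Precedes v u)
  precedes? v u = (level v <? level u) ⊎-dec
    ((level u ℕ.≟ level v) ×-dec ¬? (chosen? v) ×-dec (index u ≤? index v))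

  ahead : Fin n → List (Fin n)
  ahead v = filter (precedes? v) extras

  -- The round of v in the serial schedule, for active v.  Every farther layer takes
  -- one round for its chosen nodes and one for each of its extras.  In the layer of v
  -- the chosen nodes use the next round, and the j-th extra the j-th round after it.
  slot : Fin n → ℕ
  slot v = (height ∸ level v) + length (ahead v)

  extras! : Unique extras
  extras! = filter⁺ (¬? ∘ chosen?) (filter⁺ (_∈? T) (allFin⁺ n))

  slot-level : level v < level u → slot u < slot v
  slot-level {v} {u} lt = +-mono-<-≤ (∸-monoʳ-< lt (level≤height u))
    (Unique⇒length≤ (filter⁺ (precedes? u) extras!) λ w∈ →
      let w∈e , pre = ∈-filter⁻ (precedes? u) {xs = extras} w∈
      in ∈-filter⁺ (precedes? v) w∈e (inj₁ (earlier pre)))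
    where
    earlier : Precedes u w → level v < level w
    earlier (inj₁ lt′)      = <-trans lt lt′
    earlier (inj₂ (eq , _)) = subst (level v <_) (sym eq) lt

  -- An extra comes after the chosen nodes of its layer and after the extras of its
  -- layer with a smaller index.
  slot-extra : v ∈ˢ T → ¬ Chosen v → level u ≡ level v →
               (¬ Chosen u → index u < index v) → slot u < slot v
  slot-extra {v} {u} v∈T ¬ch eq before = +-mono-≤-< (≤-reflexive (cong (height ∸_) eq))
    (Unique⇒length≤ (All.tabulate v∉ ∷ filter⁺ (precedes? u) extras!) sub)
    where
    v∉ : w ∈ ahead u → v ≢ w
    v∉ w∈ refl with proj₂ (∈-filter⁻ (precedes? u) {xs = extras} w∈)
    ... | inj₁ lt               = <⇒≢ lt eq
    ... | inj₂ (_ , ¬chu , v≤u) = <⇒≱ (before ¬chu) v≤u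
    sub : w ∈ v ∷ ahead u → w ∈ ahead v
    sub (here refl) = ∈-filter⁺ (precedes? v) (∈-filter⁺ (¬? ∘ chosen?) (∈-members v∈T) ¬ch)
                                (inj₂ (refl , ¬ch , ≤-refl))
    sub (there w∈) with ∈-filter⁻ (precedes? u) {xs = extras} w∈
    ... | w∈e , inj₁ lt               = ∈-filter⁺ (precedes? v) w∈e (inj₁ (subst (_< _) eq lt))
    ... | w∈e , inj₂ (e , ¬chu , w≤u) = ∈-filter⁺ (precedes? v) w∈e
          (inj₂ (trans e eq , ¬ch , ≤-trans w≤u (<⇒≤ (before ¬chu))))

  slot< : Active v → slot v < height + k
  slot< {v} (_ , v≢s) = +-mono-<-≤
    (∸-monoʳ-< {height} (level>0 v≢s) (level≤height v))
    (≤-trans (length-filter (precedes? v) extras) extras≤k)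

  -- If both transmit in the same round, u prevents the parent of v from receiving.
  Spoils : Fin n → Fin n → Set
  Spoils u v = parent v ≡ u ⊎ parent v ~ u

  Clash : Fin n → Fin n → Set
  Clash u v = Active u × Active v × u ≢ v × (Spoils u v ⊎ Spoils v u)

  clash? : ∀ u v → Dec (Clash u v)
  clash? u v = active? u ×-dec active? v ×-dec ¬? (u ≟ v) ×-dec (spoils? u v ⊎-dec spoils? v u)
    where
    spoils? : ∀ u v → Dec (Spoils u v)
    spoils? u v = (parent v ≟ u) ⊎-dec (parent v ~? u)

  clash-sym : Clash u v → Clash v u
  clash-sym (au , av , ne , inj₁ s) = av , au , ne ∘ sym , inj₂ s
  clash-sym (au , av , ne , inj₂ s) = av , au , ne ∘ sym , inj₁ s

  -- A chosen node has no lower neighbour in the backbone except its parent, and a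
  -- parent selects only one child.
  private-spoils : Active u → Active v → u ≢ v → level u ≡ level v →
                   Chosen u → Chosen v → ¬ Spoils u v
  private-spoils au av ne eq cu cv (inj₁ refl) = 1+n≢n (sym (trans eq (level-parent av)))
  private-spoils {u} {v} au av ne eq cu cv (inj₂ p~u) =
    ne (trans (sym cu) (trans (cong child (sym same-parent)) cv))
    where
    same-parent : parent v ≡ parent u
    same-parent = proj₂ (proj₂ (chosen-private au cu)) _ (proj₁ (parent-spec av))
                    (~-sym p~u , trans eq (level-parent av))

  slot-clash : Clash u v → slot u ≢ slot v
  slot-clash {u} {v} (au , av , ne , sp) with <-cmp (level u) (level v)
  ... | tri< lt _ _ = >⇒≢ (slot-level lt)
  ... | tri> _ _ gt = <⇒≢ (slot-level gt)
  ... | tri≈ _ eq _ = same-level (chosen? u) (chosen? v) sp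
    where
    same-level : Dec (Chosen u) → Dec (Chosen v) → Spoils u v ⊎ Spoils v u → slot u ≢ slot v
    same-level (yes cu) (yes cv) (inj₁ s) =
      contradiction s (private-spoils au av ne eq cu cv)
    same-level (yes cu) (yes cv) (inj₂ s) =
      contradiction s (private-spoils av au (ne ∘ sym) (sym eq) cv cu)
    same-level (yes cu) (no ¬cv) _ = <⇒≢ (slot-extra (proj₁ av) ¬cv eq (contradiction cu))
    same-level (no ¬cu) (yes cv) _ = >⇒≢ (slot-extra (proj₁ au) ¬cu (sym eq) (contradiction cv))
    same-level (no ¬cu) (no ¬cv) _ with <-cmp (index u) (index v)
    ... | tri< lt _ _ = <⇒≢ (slot-extra (proj₁ av) ¬cv eq λ _ → lt)
    ... | tri≈ _ e _  = contradiction (toℕ-injective e) ne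
    ... | tri> _ _ gt = >⇒≢ (slot-extra (proj₁ au) ¬cu (sym eq) λ _ → gt)

-- Compacting a schedule

-- Before is a precedence constraint, and clashing nodes must not get the same round
-- unless they have the same slot.
module Compaction {n} (slot : Fin n → ℕ) {Before Clash : Fin n → Fin n → Set}
                  (before? : Decidable Before) (clash? : Decidable Clash)
                  (slot-before : ∀ {u v} → Before u v → slot u < slot v) where

  -- Round t is possible for v, given the rounds of the nodes with smaller slots.
  Fits : (Fin n → ℕ) → Fin n → ℕ → Set
  Fits τ v t = (∀ u → Before u v → τ u < t) × (∀ u → Clash u v → slot u < slot v → τ u ≢ t)

  fits? : ∀ τ v t → Dec (Fits τ v t)
  fits? τ v t = all? (λ u → before? u v →-dec (τ u <? t)) ×-dec
                all? (λ u → clash? u v →-dec ((slot u <? slot v) →-dec ¬? (τ u ℕ.≟ t)))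

  -- No later than the slot, possible, and first such.
  Earliest : (Fin n → ℕ) → Fin n → ℕ → Set
  Earliest τ v t = t ≤ slot v × Fits τ v t × (∀ s → s < t → ¬ Fits τ v s)

  fits-cong : ∀ {τ σ v t} → (∀ u → slot u < slot v → τ u ≡ σ u) → Fits τ v t → Fits σ v t
  fits-cong eq (bef , cla) =
    (λ u b → subst (_< _) (eq u (slot-before b)) (bef u b)) ,
    (λ u c lt e → cla u c lt (trans (eq u lt) e))

  earliest-cong : ∀ {τ σ v t} → (∀ u → slot u < slot v → τ u ≡ σ u) →
                  Earliest τ v t → Earliest σ v t
  earliest-cong eq (t≤ , fits , min) =
    t≤ , fits-cong eq fits , λ s s<t → min s s<t ∘ fits-cong λ u lt → sym (eq u lt)

  -- The slot of v is itself possible, as all nodes with smaller slots have got rounds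
  -- below it.
  earliest : ∀ τ v → (∀ u → slot u < slot v → τ u ≤ slot u) → ∃ (Earliest τ v)
  earliest τ v τ≤ = least (fits? τ v) (slot v)
    ((λ u b → ≤-<-trans (τ≤ u (slot-before b)) (slot-before b)) ,
     (λ u _ lt → <⇒≢ (≤-<-trans (τ≤ u lt) lt)))

  -- By induction on b, the nodes with slot b are assigned their rounds last.
  compact-below : ∀ b → ∃ λ τ → ∀ v → slot v < b → Earliest τ v (τ v)
  compact-below zero    = (λ _ → 0) , λ _ ()
  compact-below (suc b) with compact-below b
  ... | τ , good = τ′ , good′
    where
    at-b : ∀ v → slot v ≡ b → ∃ (Earliest τ v)
    at-b v eq = earliest τ v λ u lt → proj₁ (good u (subst (slot u <_) eq lt))
    τ′ : Fin n → ℕ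
    τ′ v with slot v ℕ.≟ b
    ... | yes eq = proj₁ (at-b v eq)
    ... | no  _  = τ v
    τ′-old : ∀ v → slot v < b → τ v ≡ τ′ v
    τ′-old v lt with slot v ℕ.≟ b
    ... | yes eq = contradiction eq (<⇒≢ lt)
    ... | no  _  = refl
    good′ : ∀ v → slot v < suc b → Earliest τ′ v (τ′ v)
    good′ v (s≤s le) = earliest-cong (λ u lt → τ′-old u (<-≤-trans lt le)) old
      where
      old : Earliest τ v (τ′ v)
      old with slot v ℕ.≟ b
      ... | yes eq = proj₂ (at-b v eq)
      ... | no  ne = good v (≤∧≢⇒< le ne)

-- The compacted schedule and its locality

module Schedule {k} (I : Instance k) where
  open Backbone I public

  private variable
    u v w p : Fin n

  Before : Fin n → Fin n → Set
  Before u v = Active u × Active v × parent u ≡ v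

  before? : Decidable Before
  before? u v = active? u ×-dec active? v ×-dec (parent u ≟ v)

  slot-before : Before u v → slot u < slot v
  slot-before (au , _ , refl) = slot-level (≤-reflexive (sym (level-parent au)))

  open Compaction slot before? clash? slot-before

  abstract
    compacted : ∃ λ τ → ∀ v → slot v < height + k → Earliest τ v (τ v)
    compacted = compact-below (height + k)

  -- The round in which an active node transmits.
  time : Fin n → ℕ
  time = proj₁ compacted

  time-earliest : Active v → Earliest time v (time v)
  time-earliest act = proj₂ compacted _ (slot< act)

  time< : Active v → time v < height + k
  time< act = ≤-<-trans (proj₁ (time-earliest act)) (slot< act)

  time-parent : Active u → Active (parent u) → time u < time (parent u)
  time-parent au ap = proj₁ (proj₁ (proj₂ (time-earliest ap))) _ (au , ap , refl)

  time-clash : Clash u v → time u ≢ time v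
  time-clash {u} {v} c with <-cmp (slot u) (slot v)
  ... | tri< lt _ _ = proj₂ (proj₁ (proj₂ (time-earliest (proj₁ (proj₂ c))))) u c lt
  ... | tri≈ _ eq _ = contradiction eq (slot-clash c)
  ... | tri> _ _ gt = proj₂ (proj₁ (proj₂ (time-earliest (proj₁ c)))) v (clash-sym c) gt ∘ sym

  -- An earlier round was too early for a child or taken by a clashing node.
  time-tight : Active v → ∀ t → t < time v →
               (∃ λ u → Before u v × t ≤ time u) ⊎ (∃ λ u → Clash u v × time u ≡ t)
  time-tight {v} act t lt
    with any? (λ u → before? u v ×-dec (t ≤? time u)) | any? (λ u → clash? u v ×-dec (time u ℕ.≟ t))
  ... | yes found | _         = inj₁ found
  ... | no  _     | yes found = inj₂ found
  ... | no  none₁ | no  none₂ = contradiction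
        ((λ u b → ≰⇒> λ le → none₁ (u , b , le)) , λ u c _ eq → none₂ (u , c , eq))
        (proj₂ (proj₂ (time-earliest act)) t lt)

  nearby-levels : ℕ → List ℕ
  nearby-levels l = l ∷ suc l ∷ suc (suc l) ∷ l ∸ 1 ∷ l ∸ 2 ∷ []

  ∈-nearby-levels : ∀ {a b} → a ≤ 2 + b → b ≤ 2 + a → a ∈ nearby-levels b
  ∈-nearby-levels {a} {b} a≤ b≤ with ≤-total b a
  ... | inj₁ b≤a with a ∸ b | sym (m∸n+n≡m b≤a)
  ...   | 0 | refl = here refl
  ...   | 1 | refl = there (here refl)
  ...   | 2 | refl = there (there (here refl))
  ...   | suc (suc (suc d)) | refl = contradiction a≤ (<⇒≱ (s≤s (s≤s (s≤s (m≤n+m b d)))))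
  ∈-nearby-levels {a} {b} a≤ b≤ | inj₂ a≤b with b ∸ a | sym (m∸n+n≡m a≤b)
  ...   | 0 | refl = here refl
  ...   | 1 | refl = there (there (there (here refl)))
  ...   | 2 | refl = there (there (there (there (here refl))))
  ...   | suc (suc (suc d)) | refl = contradiction b≤ (<⇒≱ (s≤s (s≤s (s≤s (m≤n+m a d)))))

  -- The nodes that clash with v or whose transmissions v may receive.
  Audible : Fin n → Fin n → Set
  Audible u v = Active u × (Clash u v ⊎ v ~ u)

  -- A list of length 5k that contains the audible nodes.
  by-layers : Fin n → List (Fin n)
  by-layers v = concatMap layer (nearby-levels (level v))

  length-by-layers : ∀ v → length (by-layers v) ≤ 5 * k
  length-by-layers v = length-concatMap layer (nearby-levels (level v)) k λ {l} _ →
    ≤-reflexive (length-layer l)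

  spoils-levels : Active v → Spoils u v → level u ≤ level v × level v ≤ 2 + level u
  spoils-levels av (inj₁ refl) rewrite level-parent av = n≤1+n _ , n≤1+n _
  spoils-levels av (inj₂ p~u) rewrite level-parent av = level-~ (~-sym p~u) , s≤s (level-~ p~u)

  audible-levels : Active v → Audible u v → level u ≤ 2 + level v × level v ≤ 2 + level u
  audible-levels av (au , inj₁ (_ , _ , _ , inj₁ s)) with spoils-levels av s
  ... | a , b = m≤n⇒m≤1+n (m≤n⇒m≤1+n a) , b
  audible-levels av (au , inj₁ (_ , _ , _ , inj₂ s)) with spoils-levels au s
  ... | a , b = b , m≤n⇒m≤1+n (m≤n⇒m≤1+n a)
  audible-levels av (au , inj₂ v~u) = m≤n⇒m≤1+n (level-~ (~-sym v~u)) , m≤n⇒m≤1+n (level-~ v~u)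

  ∈-by-layers : Active v → Audible u v → u ∈ by-layers v
  ∈-by-layers {v} {u} av aud with audible-levels av aud
  ... | a , b = ∈-concatMap⁺ layer {xs = nearby-levels (level v)}
        (Any.map (λ { refl → ∈-layer (proj₁ (proj₁ aud)) }) (∈-nearby-levels a b))

  -- A list of length quadratic in the maximum degree that contains the audible nodes:
  -- the nodes within two steps of v, and those within one step of its parent.
  by-steps : Fin n → List (Fin n)
  by-steps v = concatMap neighbours (v ∷ neighbours v) ++ parent v ∷ neighbours (parent v)

  ∈-neighbours : v ~ u → u ∈ neighbours v
  ∈-neighbours v~u = ∈-filter⁺ (_ ~?_) (∈-allFin _) v~u

  neighbours-~ : u ∈ neighbours v → v ~ u
  neighbours-~ {u} {v} u∈ = proj₂ (∈-filter⁻ (v ~?_) {xs = allFin n} u∈)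

  length-by-steps : ∀ {Δ} → (∀ v → degree v ≤ Δ) → 1 ≤ Δ →
                    ∀ v → length (by-steps v) ≤ 4 * (Δ * Δ)
  length-by-steps {Δ} deg 1≤Δ v = begin
    length (by-steps v)
      ≡⟨ length-++ (concatMap neighbours (v ∷ neighbours v)) ⟩
    length (concatMap neighbours (v ∷ neighbours v)) + suc (degree (parent v))
      ≤⟨ +-mono-≤ (length-concatMap neighbours (v ∷ neighbours v) Δ λ {w} _ → deg w)
                  (s≤s (deg (parent v))) ⟩
    suc (degree v) * Δ + suc Δ
      ≤⟨ +-mono-≤ (*-monoˡ-≤ Δ (s≤s (deg v))) (+-monoˡ-≤ Δ 1≤Δ) ⟩
    (Δ + Δ * Δ) + (Δ + Δ)
      ≤⟨ +-mono-≤ (+-monoˡ-≤ (Δ * Δ) Δ≤Δ²) (+-mono-≤ Δ≤Δ² Δ≤Δ²) ⟩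
    (Δ * Δ + Δ * Δ) + (Δ * Δ + Δ * Δ)
      ≡⟨ +-assoc (Δ * Δ) (Δ * Δ) _ ⟩
    Δ * Δ + (Δ * Δ + (Δ * Δ + Δ * Δ))
      ≡⟨ cong (λ x → Δ * Δ + (Δ * Δ + (Δ * Δ + x))) (sym (+-identityʳ (Δ * Δ))) ⟩
    4 * (Δ * Δ) ∎
    where
    open ≤-Reasoning
    Δ≤Δ² : Δ ≤ Δ * Δ
    Δ≤Δ² = m≤m*n Δ Δ {{>-nonZero 1≤Δ}}

  ∈-by-steps : Audible u v → u ∈ by-steps v
  ∈-by-steps {u} {v} (_ , inj₂ v~u) = ∈-++⁺ˡ (∈-++⁺ˡ (∈-neighbours v~u))
  ∈-by-steps {u} {v} (au , inj₁ (_ , _ , _ , inj₁ (inj₁ refl))) =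
    ∈-++⁺ʳ (concatMap neighbours (v ∷ neighbours v)) (here refl)
  ∈-by-steps {u} {v} (au , inj₁ (_ , _ , _ , inj₁ (inj₂ p~u))) =
    ∈-++⁺ʳ (concatMap neighbours (v ∷ neighbours v)) (there (∈-neighbours p~u))
  ∈-by-steps {u} {v} (au , inj₁ (_ , _ , _ , inj₂ s)) = ∈-++⁺ˡ
    (∈-concatMap⁺ neighbours {xs = v ∷ neighbours v}
      (Any.map (λ { refl → ∈-neighbours (~-sym (proj₁ (proj₂ (parent-spec au)))) }) (parent∈ s)))
    where
    parent∈ : Spoils v u → parent u ∈ v ∷ neighbours v
    parent∈ (inj₁ refl) = here refl
    parent∈ (inj₂ p~v)  = there (∈-neighbours (~-sym p~v))

-- The algorithm

_≟ˡ_ : (l m : Label) → Dec (l ≡ m)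
_≟ˡ_ = list-≟ _≟ᵇ_

learnt : Maybe Message → List Message
learnt (just m) = decode m
learnt nothing  = []

-- All source messages that a node has learnt: a transmission is the code of a list
-- of source messages.
gathered : Maybe Message → History → List Message
gathered own h = fromMaybe own ++ concatMap learnt h

-- A node transmits everything it knows, in the rounds in which the code of its past
-- receptions is its label.
relay : Algorithm
relay = record
  { transmit = λ l own h → if does (l ≟ˡ code (map is-just h))
                           then just (encode (gathered own h)) else nothing
  ; known    = λ _ → gathered
  }

-- Reception

module Listening {n} (G : Graph n) {A : Set} where
  open Graph G hiding (sym)

  -- What v receives when f gives the transmissions of all nodes.
  listen : (Fin n → Maybe A) → Fin n → Maybe A
  listen f v with f v
  ... | just _  = nothing
  ... | nothing = only (mapMaybe f (neighbours v))

  only-∈ : ∀ {f : Fin n → Maybe A} ws {a} → only (mapMaybe f ws) ≡ just a →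
           ∃ λ w → w ∈ ws × f w ≡ just a
  only-∈ {f} (w ∷ ws) eq with f w in fw
  ... | nothing with only-∈ ws eq
  ...   | x , x∈ , fx = x , there x∈ , fx
  only-∈ {f} (w ∷ ws) eq | just b with mapMaybe f ws
  only-∈ {f} (w ∷ ws) refl | just b | [] = w , here refl , fw

  mapMaybe-silent : ∀ {f : Fin n → Maybe A} ws → (∀ w → w ∈ ws → f w ≡ nothing) →
                    mapMaybe f ws ≡ []
  mapMaybe-silent []       _ = refl
  mapMaybe-silent {f} (w ∷ ws) silent with f w | silent w (here refl)
  ... | nothing | refl = mapMaybe-silent ws λ x x∈ → silent x (there x∈)

  mapMaybe-single : ∀ {f : Fin n → Maybe A} {ws u a} → Unique ws → u ∈ ws → f u ≡ just a →
                    (∀ w → w ∈ ws → w ≢ u → f w ≡ nothing) → mapMaybe f ws ≡ a ∷ []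
  mapMaybe-single {f} {w ∷ ws} (w∉ ∷ _) (here refl) fu rest with f w | fu
  ... | just a | refl = cong (a ∷_) (mapMaybe-silent ws λ x x∈ →
        rest x (there x∈) λ eq → All.lookup w∉ x∈ (sym eq))
  mapMaybe-single {f} {w ∷ ws} (w∉ ∷ !ws) (there u∈) fu rest
    with f w | rest w (here refl) (All.lookup w∉ u∈)
  ... | nothing | refl = mapMaybe-single !ws u∈ fu λ x x∈ → rest x (there x∈)

  listen-single : ∀ {f : Fin n → Maybe A} {v u a} → f v ≡ nothing → v ~ u → f u ≡ just a →
                  (∀ w → v ~ w → w ≢ u → f w ≡ nothing) → listen f v ≡ just a
  listen-single {f} {v} {u} fv v~u fu rest with f v | fv
  ... | nothing | refl = cong only (mapMaybe-single (filter⁺ (v ~?_) (allFin⁺ n))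
        (∈-filter⁺ (v ~?_) (∈-allFin u) v~u) fu λ w w∈ →
          rest w (proj₂ (∈-filter⁻ (v ~?_) {xs = allFin n} w∈)))

  listen-from : ∀ {f : Fin n → Maybe A} {v a} → listen f v ≡ just a →
                ∃ λ w → w ∈ neighbours v × f w ≡ just a
  listen-from {f} {v} eq with f v
  ... | nothing = only-∈ (neighbours v) eq

-- Whether a node receives depends only on who transmits, not on the contents.
module _ {n} (G : Graph n) {A B : Set} where
  open Graph G hiding (sym)
  open Listening G

  length-mapMaybe-cong : ∀ {f : Fin n → Maybe A} {g : Fin n → Maybe B} →
                         (∀ v → is-just (f v) ≡ is-just (g v)) → ∀ ws →
                         length (mapMaybe f ws) ≡ length (mapMaybe g ws)
  length-mapMaybe-cong eq [] = refl
  length-mapMaybe-cong {f} {g} eq (w ∷ ws) with f w | g w | eq w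
  ... | just _  | just _  | _ = cong suc (length-mapMaybe-cong eq ws)
  ... | nothing | nothing | _ = length-mapMaybe-cong eq ws

  only-cong : ∀ (xs : List A) (ys : List B) → length xs ≡ length ys →
              is-just (only xs) ≡ is-just (only ys)
  only-cong []          []          _ = refl
  only-cong (_ ∷ [])    (_ ∷ [])    _ = refl
  only-cong (_ ∷ _ ∷ _) (_ ∷ _ ∷ _) _ = refl

  listen-cong : ∀ {f : Fin n → Maybe A} {g : Fin n → Maybe B} →
                (∀ v → is-just (f v) ≡ is-just (g v)) → ∀ v →
                is-just (listen f v) ≡ is-just (listen g v)
  listen-cong {f} {g} eq v with f v | g v | eq v
  ... | just _  | just _  | _ = refl
  ... | nothing | nothing | _ = only-cong _ _ (length-mapMaybe-cong eq (neighbours v))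

-- The planned run and the labels

module Plan {k} (I : Instance k) where
  open Schedule I public

  private variable
    u v w p : Fin n

  -- v is to transmit in round t.
  Due : ℕ → Fin n → Set
  Due t v = Active v × time v ≡ t

  due? : ∀ t v → Dec (Due t v)
  due? t v = active? v ×-dec (time v ℕ.≟ t)

  abstract
    -- The planned transmissions of round t, without contents.
    plan : ℕ → Fin n → Maybe Unit
    plan t v = if does (due? t v) then just tt else nothing

    plan-due : ∀ {t} → Due t v → plan t v ≡ just tt
    plan-due {v} {t} d = cong (if_then just tt else nothing) (dec-true (due? t v) d)

    plan-idle : ∀ {t} → ¬ Due t v → plan t v ≡ nothing
    plan-idle {v} {t} ¬d = cong (if_then just tt else nothing) (dec-false (due? t v) ¬d)

  open Listening graph public

  -- Whether v receives something in round t of the planned run.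
  hears : Fin n → ℕ → Bool
  hears v t = is-just (listen (plan t) v)

  -- In which of the first t rounds v is to receive something, most recent first.
  planned : ℕ → Fin n → List Bool
  planned t v = transcript (hears v) t

  abstract
    -- The code of an active node is nonempty, so the empty label stands for silence.
    label-of : Fin n → Label
    label-of v = if does (active? v) then code (planned (time v) v) else []

    label-active : Active v → label-of v ≡ code (planned (time v) v)
    label-active {v} av = cong (if_then code (planned (time v) v) else []) (dec-true (active? v) av)

    label-inactive : ¬ Active v → label-of v ≡ []
    label-inactive {v} ¬av =
      cong (if_then code (planned (time v) v) else []) (dec-false (active? v) ¬av)

  parent-idle : Active u → ¬ Due (time u) (parent u)
  parent-idle au (ap , eq) = <⇒≢ (time-parent au ap) (sym eq)

  others-idle : Active u → ∀ w → parent u ~ w → w ≢ u → ¬ Due (time u) w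
  others-idle au w p~w w≢u (aw , eq) = time-clash (aw , au , w≢u , inj₁ (inj₂ p~w)) eq

  parent-receives : ∀ {A : Set} {f : Fin n → Maybe A} {a} → Active u →
                    (∀ w → ¬ Due (time u) w → f w ≡ nothing) → f u ≡ just a →
                    Listening.listen graph f (parent u) ≡ just a
  parent-receives au idle fu =
    listen-single (idle _ (parent-idle au)) (~-sym (proj₁ (proj₂ (parent-spec au)))) fu
      λ w p~w w≢u → idle w (others-idle au w p~w w≢u)

  parent-hears : Active u → hears (parent u) (time u) ≡ true
  parent-hears au = cong is-just (parent-receives au (λ w → plan-idle) (plan-due (au , refl)))

  heard-from : ∀ {t} → hears v t ≡ true → ∃ λ w → v ~ w × Due t w
  heard-from {v} {t} eq with listen (plan t) v in lv
  ... | just _ with listen-from lv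
  ...   | w , w∈ , pw = w , neighbours-~ w∈ ,
          decidable-stable (due? t w) λ ¬d → contradiction (trans (sym pw) (plan-idle ¬d)) λ ()

  -- The rounds counted in the label of v are distinct transmission rounds of audible
  -- nodes.
  module _ {v : Fin n} (av : Active v) (ys : List (Fin n))
           (near : ∀ {u} → Audible u v → u ∈ ys) where

    heard≤ : heard (planned (time v) v) ≤ length ys
    heard≤ with heard-times (hears v) (time v)
    ... | zs , !zs , len , mem =
        subst₂ _≤_ len (length-map time ys) (Unique⇒length≤ !zs λ s∈ →
          let _ , eq = mem s∈
              w , v~w , aw , tw = heard-from eq
          in subst (_∈ map time ys) tw (∈-map⁺ time (near (aw , inj₂ v~w))))

    silence≤ : silence (planned (time v) v) ≤ length ys
    silence≤ with quiet-times (hears v) (time v)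
    ... | zs , !zs , len , mem =
        subst₂ _≤_ len (length-map time ys) (Unique⇒length≤ !zs λ s∈ → blame (mem s∈))
      where
      blame : ∀ {s} → QuietTime (hears v) (time v) s → s ∈ map time ys
      blame {s} (s<t , quiet) with time-tight av s s<t
      ... | inj₂ (u , c , refl) = ∈-map⁺ time (near (proj₁ c , inj₁ c))
      -- A child that transmits in round s or later would break the silence.
      ... | inj₁ (u , (au , _ , refl) , s≤) =
            contradiction (trans (sym (parent-hears au)) (quiet _ s≤ (time-parent au av))) λ ()

  wakes : ∀ {s t} (f : ℕ → Bool) → s < t → f s ≡ true → or (transcript f t) ≡ true
  wakes {s} {suc t} f (s≤s s≤t) fs with f t in ft
  ... | true  = refl
  ... | false with m≤n⇒m<n∨m≡n s≤t
  ...   | inj₁ s<t  = wakes f s<t fs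
  ...   | inj₂ refl = contradiction (trans (sym ft) fs) λ ()

  -- A non-source is woken by its private child before its own round.
  relay-woken : Active v → ¬ Source v → or (planned (time v) v) ≡ true
  relay-woken {v} av ¬src with child-private (proj₁ av) ¬src
  ... | pr@(ac , _) = subst (λ x → or (planned (time x) x) ≡ true) (parent-private pr)
        (wakes (hears (parent (child v)))
               (time-parent ac (subst Active (sym (parent-private pr)) av)) (parent-hears ac))

-- The actual run

module Run {k} (I : Instance k) (message : Fin k → Message) where
  open Plan I
  open Execution relay I label-of message
    using (ownMessage; sent; received; histories; knows; Gathered)

  private variable
    u v w p : Fin n

  own-source : ∀ i → ownMessage (source i) ≡ just (message i)
  own-source i with any? (λ j → source j ≟ source i)
  ... | yes (j , eq) = cong (just ∘ message) (distinct eq)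
  ... | no  none     = contradiction (i , refl) none

  own-message : ∀ {m} → ownMessage v ≡ just m → ∃ λ i → message i ≡ m
  own-message {v} eq with any? (λ j → source j ≟ v)
  own-message refl | yes (j , _) = j , refl

  -- At the start of round t every node has received exactly when planned.
  Consistent : ℕ → Set
  Consistent t = ∀ v → map is-just (histories t v) ≡ planned t v

  received-listen : ∀ h v → received h v ≡ listen (sent h) v
  received-listen h v with sent h v
  ... | just _  = refl
  ... | nothing = refl

  module _ {t} (ok : Consistent t) where

    code-due : Due t v → label-of v ≡ code (map is-just (histories t v))
    code-due {v} (av , refl) = trans (label-active av) (cong code (sym (ok v)))

    code-idle : ¬ Due t v → label-of v ≢ code (map is-just (histories t v))
    code-idle {v} ¬d eq =
      [ due
      , (λ ¬av → code≢[] (map is-just (histories t v)) (trans (sym eq) (label-inactive ¬av)))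
      ]′ (toSum (active? v))
      where
      due : ¬ Active v
      due av = ¬d (av , code-transcript-injective (hears v) (time v) t
        (trans (sym (label-active av)) (trans eq (cong code (ok v)))))

    awake-due : Due t v → awake (ownMessage v) (histories t v) ≡ true
    awake-due {v} (av , refl) =
      [ (λ { (i , refl) → awake-own (own-source i) })
      , (λ ¬src → awake-woken (ownMessage v) (trans (cong or (ok v)) (relay-woken av ¬src)))
      ]′ (toSum (source? v))
      where
      awake-own : ∀ {o m} → o ≡ just m → awake o (histories t v) ≡ true
      awake-own refl = refl
      awake-woken : ∀ o → or (map is-just (histories t v)) ≡ true → awake o (histories t v) ≡ true
      awake-woken (just _) _ = refl
      awake-woken nothing  w = w

    sent-due : Due t v → sent (histories t) v ≡ just (encode (knows t v))
    sent-due {v} d = trans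
      (cong (if_then Algorithm.transmit relay (label-of v) (ownMessage v) (histories t v)
             else nothing) (awake-due d))
      (cong (if_then just (encode (knows t v)) else nothing) (dec-true (_ ≟ˡ _) (code-due d)))

    sent-idle : ¬ Due t v → sent (histories t) v ≡ nothing
    sent-idle {v} ¬d with awake (ownMessage v) (histories t v)
    ... | false = refl
    ... | true  =
          cong (if_then just (encode (knows t v)) else nothing) (dec-false (_ ≟ˡ _) (code-idle ¬d))

    sent-plan : ∀ v → is-just (sent (histories t) v) ≡ is-just (plan t v)
    sent-plan v =
      [ (λ d  → trans (cong is-just (sent-due d)) (sym (cong is-just (plan-due d))))
      , (λ ¬d → trans (cong is-just (sent-idle ¬d)) (sym (cong is-just (plan-idle ¬d))))
      ]′ (toSum (due? t v))

  consistent : ∀ t → Consistent t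
  consistent zero    v = refl
  consistent (suc t) v = cong₂ _∷_
    (trans (cong is-just (received-listen (histories t) v))
           (listen-cong graph (sent-plan (consistent t)) v))
    (consistent t v)

  sent-knows : ∀ t v {m} → sent (histories t) v ≡ just m → m ≡ encode (knows t v)
  sent-knows t v eq =
    [ (λ d → just-injective (trans (sym eq) (sent-due (consistent t) d)))
    , (λ ¬d → contradiction (trans (sym eq) (sent-idle (consistent t) ¬d)) λ ())
    ]′ (toSum (due? t v))

  Genuine : Message → Set
  Genuine m = ∃ λ i → message i ≡ m

  knows-genuine : ∀ t v {m} → m ∈ knows t v → Genuine m
  knows-genuine t v m∈ with ∈-++⁻ (fromMaybe (ownMessage v)) m∈
  ... | inj₁ m∈own = from-own m∈own
    where
    from-own : ∀ {m} → m ∈ fromMaybe (ownMessage v) → Genuine m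
    from-own m∈ with ownMessage v in eq
    from-own (here refl) | just _ = own-message eq
  knows-genuine (suc t) v m∈ | inj₂ m∈h with ∈-++⁻ (learnt (received (histories t) v)) m∈h
  ... | inj₂ m∈past = knows-genuine t v (∈-++⁺ʳ (fromMaybe (ownMessage v)) m∈past)
  ... | inj₁ m∈new with received (histories t) v in rec
  ...   | just y with listen-from (trans (sym (received-listen (histories t) v)) rec)
  ...     | w , _ , sw = knows-genuine t w (subst (_ ∈_)
            (trans (cong decode (sent-knows t w sw)) (decode-encode (knows t w))) m∈new)

  knows-suc : ∀ t v {m} → m ∈ knows t v → m ∈ knows (suc t) v
  knows-suc t v m∈ with ∈-++⁻ (fromMaybe (ownMessage v)) m∈
  ... | inj₁ m∈own = ∈-++⁺ˡ m∈own
  ... | inj₂ m∈h   =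
        ∈-++⁺ʳ (fromMaybe (ownMessage v)) (∈-++⁺ʳ (learnt (received (histories t) v)) m∈h)

  knows-mono : ∀ {s t m} → s ≤ t → m ∈ knows s v → m ∈ knows t v
  knows-mono {v} {s} {zero}  z≤n m∈ = m∈
  knows-mono {v} {s} {suc t} s≤t m∈ with m≤n⇒m<n∨m≡n s≤t
  ... | inj₁ (s≤s s≤t′) = knows-suc t v (knows-mono s≤t′ m∈)
  ... | inj₂ refl       = m∈

  knows-parent : ∀ {m} → Active u → m ∈ knows (time u) u → m ∈ knows (suc (time u)) (parent u)
  knows-parent {u} au m∈ = ∈-++⁺ʳ (fromMaybe (ownMessage (parent u)))
    (∈-++⁺ˡ (subst (λ r → _ ∈ learnt r) (sym rec)
      (subst (_ ∈_) (sym (decode-encode (knows (time u) u))) m∈)))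
    where
    ok = consistent (time u)
    rec : received (histories (time u)) (parent u) ≡ just (encode (knows (time u) u))
    rec = trans (received-listen _ _)
                (parent-receives au (λ w → sent-idle ok) (sent-due ok (au , refl)))

  module _ {t} (late : height + k ≤ t) {m : Message} where

    -- A message known to a member by its round, or to the sink by round t, gets to
    -- the sink.
    climb : ∀ l v → level v ≤ l → v ∈ˢ T → (Active v → m ∈ knows (time v) v) →
            (v ≡ sink → m ∈ knows t v) → m ∈ knows t sink
    climb l v lv v∈T act-knows sink-knows with v ≟ sink
    ... | yes refl = sink-knows refl
    climb zero    v lv v∈T act-knows sink-knows | no v≢s = contradiction (level>0 v≢s) (≤⇒≯ lv)
    climb (suc l) v lv v∈T act-knows sink-knows | no v≢s =
      climb l (parent v) (s≤s⁻¹ (subst (_≤ suc l) (level-parent av) lv))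
        (proj₁ (parent-spec av))
        (λ ap → knows-mono (time-parent av ap) (knows-parent av (act-knows av)))
        (λ _ → knows-mono (≤-trans (time< av) late) (knows-parent av (act-knows av)))
      where av = v∈T , v≢s

  gathers : ∀ t → height + k ≤ t → Gathered t
  gathers t late m = mk⇔ (knows-genuine t sink) complete
    where
    initial : ∀ s i → message i ∈ knows s (source i)
    initial s i = ∈-++⁺ˡ (subst (λ o → message i ∈ fromMaybe o) (sym (own-source i)) (here refl))
    complete : Genuine m → m ∈ knows t sink
    complete (i , refl) = climb late (level (source i)) (source i) ≤-refl (proj₁ T-closed i)
      (λ _ → initial (time (source i)) i) (λ _ → initial t i)

-- The length of the labels

length-code : ∀ p j → heard p < 2 ^ j → silence p < 2 ^ j → length (code p) ≤ 2 + 4 * j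
length-code p j h s = begin
  length (code p)
    ≡⟨ length-frame b (frame c []) ⟩
  2 * length b + suc (length (frame c []))
    ≡⟨ cong (λ x → 2 * length b + suc x) (length-frame c []) ⟩
  2 * length b + suc (2 * length c + 1)
    ≤⟨ +-mono-≤ (*-monoʳ-≤ 2 (length-binary _ j h))
                (s≤s (+-monoˡ-≤ 1 (*-monoʳ-≤ 2 (length-binary _ j s)))) ⟩
  2 * j + suc (2 * j + 1)
    ≡⟨ solve 1 (λ x → con 2 :* x :+ (con 1 :+ (con 2 :* x :+ con 1)) := con 2 :+ con 4 :* x)
               refl j ⟩
  2 + 4 * j ∎
  where
  open ≤-Reasoning
  b = binary (heard p)
  c = binary (silence p)

5m²<2^ : ∀ m n → n ≤ 5 * (m * m) → n < 2 ^ (5 + 2 * ⌊log₂ m ⌋)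
5m²<2^ m n le = begin-strict
  n                            ≤⟨ le ⟩
  5 * (m * m)                  <⟨ *-mono-< (m≤m+n 6 2) (*-mono-< m< m<) ⟩
  8 * (2 ^ suc l * 2 ^ suc l)  ≡⟨ cong (8 *_) (sym (^-distribˡ-+-* 2 (suc l) (suc l))) ⟩
  2 ^ 3 * 2 ^ (suc l + suc l)  ≡⟨ sym (^-distribˡ-+-* 2 3 (suc l + suc l)) ⟩
  2 ^ (3 + (suc l + suc l))
    ≡⟨ cong (2 ^_) (solve 1 (λ x → con 3 :+ ((con 1 :+ x) :+ (con 1 :+ x)) := con 5 :+ con 2 :* x)
                            refl l) ⟩
  2 ^ (5 + 2 * l)              ∎
  where
  open ≤-Reasoning
  l  = ⌊log₂ m ⌋
  m< = n<2^[1+⌊log₂n⌋] m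

module _ {k} (I : Instance k) (1≤k : 1 ≤ k) {Δ}
         (deg : ∀ v → Instance.degree I v ≤ Δ) (1≤Δ : 1 ≤ Δ) where
  open Plan I

  -- The hypothesis on m has the form of heard≤ and silence≤; the two lists used are
  -- by-layers v and by-steps v.
  statistic< : ∀ {v} → Active v → ∀ m →
               (∀ ys → (∀ {u} → Audible u v → u ∈ ys) → m ≤ length ys) →
               m < 2 ^ (5 + 2 * ⌊log₂ k ⊓ Δ ⌋)
  statistic< {v} av m m≤ = 5m²<2^ (k ⊓ Δ) m bound
    where
    m≤k : m ≤ 5 * k
    m≤k = ≤-trans (m≤ (by-layers v) (∈-by-layers av)) (length-by-layers v)
    m≤Δ : m ≤ 4 * (Δ * Δ)
    m≤Δ = ≤-trans (m≤ (by-steps v) ∈-by-steps) (length-by-steps deg 1≤Δ v)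
    bound : m ≤ 5 * ((k ⊓ Δ) * (k ⊓ Δ))
    bound with ⊓-sel k Δ
    ... | inj₁ eq rewrite eq = ≤-trans m≤k (*-monoʳ-≤ 5 (m≤m*n k k {{>-nonZero 1≤k}}))
    ... | inj₂ eq rewrite eq = ≤-trans m≤Δ (*-monoˡ-≤ (Δ * Δ) (n≤1+n 4))

  label-length : ∀ v → length (label-of v) ≤ 22 * (1 + (⌊log₂ k ⌋ ⊓ ⌊log₂ Δ ⌋))
  label-length v =
    [ length-active
    , (λ ¬av → subst (λ l → length l ≤ bound) (sym (label-inactive ¬av)) z≤n)
    ]′ (toSum (active? v))
    where
    open ≤-Reasoning
    bound = 22 * (1 + (⌊log₂ k ⌋ ⊓ ⌊log₂ Δ ⌋))
    l     = ⌊log₂ k ⊓ Δ ⌋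
    length-active : Active v → length (label-of v) ≤ bound
    length-active av = begin
      length (label-of v)
        ≡⟨ cong length (label-active av) ⟩
      length (code (planned (time v) v))
        ≤⟨ length-code _ (5 + 2 * l) (statistic< av _ (heard≤ av)) (statistic< av _ (silence≤ av)) ⟩
      2 + 4 * (5 + 2 * l)
        ≡⟨ solve 1 (λ x → con 2 :+ con 4 :* (con 5 :+ con 2 :* x) := con 22 :+ con 8 :* x) refl l ⟩
      22 + 8 * l
        ≤⟨ +-monoʳ-≤ 22 (*-monoˡ-≤ l (m≤m+n 8 14)) ⟩
      22 + 22 * l
        ≡⟨ sym (*-suc 22 l) ⟩
      22 * suc l
        ≤⟨ *-monoʳ-≤ 22 (s≤s (⊓-glb (⌊log₂⌋-mono-≤ (m⊓n≤m k Δ)) (⌊log₂⌋-mono-≤ (m⊓n≤n k Δ)))) ⟩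
      22 * (1 + (⌊log₂ k ⌋ ⊓ ⌊log₂ Δ ⌋)) ∎

theorem2 : Σ[ C ∈ ℕ ] Σ[ scheme ∈ LabelingScheme ] Σ[ 𝒜 ∈ Algorithm ]
    (∀ (k : ℕ) → 1 ≤ k → (I : Instance k) (D Δ : ℕ) →
    Instance.Diameter I D → Instance.MaxDegree I Δ → 1 ≤ Δ →
    (schemeLength scheme I ≤ C * (1 + (⌊log₂ k ⌋ ⊓ ⌊log₂ Δ ⌋)))
    × AccomplishesGathering 𝒜 scheme I (D + k))
theorem2 = 22 , (λ I → Plan.label-of I) , relay , λ k 1≤k I D Δ diam (deg , _) 1≤Δ →
  max≤v⁺ z≤n (All-map⁺ (All.universal (label-length I 1≤k deg 1≤Δ) (allFin (Instance.n I)))) ,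
  λ message t late → Run.gathers I message t
    (≤-trans (+-monoˡ-≤ k (Backbone.height≤diameter I diam)) late)
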